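{- Let $q=3^d$ with $d$ even, and let $\beta$ be a fixed primitive root of $\mathbb{F}_q^\times$ (a generator of the multiplicative group). Consider the elliptic curves $E\colon y^2=x^3-\beta x$ and $E'\colon y^2=x^3-\beta^3x$ over $\mathbb{F}_q$. Then $\#E(\mathbb{F}_q)=\#E'(\mathbb{F}_q)=q+1$.
   Context: $\#E(\mathbb{F}_q)$ counts all $\mathbb{F}_q$-rational points, including the point at infinity. -}

module Defs where

import Algebra.Apartness.Properties.HeytingCommutativeRing as HeytingProperties
open import Algebra.Apartness.Bundles using (HeytingCommutativeRing; HeytingField)
open import Algebra.Bundles using (CommutativeRing)
import Algebra.Properties.CommutativeMonoid.Sum as SumProperties
import Algebra.Properties.Ring as RingProperties
import Algebra.Properties.Semiring.Exp as Exp
import Algebra.Properties.Semiring.Mult as Mult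
import Algebra.Solver.Ring.NaturalCoefficients.Default as NaturalSolver
open import Data.Fin.Base using (Fin)
open import Data.Fin.Permutation using (Permutation′; permutation; _⟨$⟩ʳ_)
import Data.Maybe.Relation.Binary.Pointwise as Maybe
open import Data.Nat.Base as ℕ using (ℕ; zero; suc)
import Data.Nat.Tactic.RingSolver as ℕSolver
open import Data.Product.Base using (∃-syntax; _,_)
open import Data.Product.Relation.Binary.Pointwise.NonDependent using (×-setoid)
open import Function.Bundles using (Inverse)
open import Level using (_⊔_)
open import Relation.Binary.Bundles using (Setoid)
import Relation.Binary.Construct.On as On
open import Relation.Binary.PropositionalEquality as ≡ using (_≡_)
import Relation.Binary.Reasoning.Setoid as SetoidReasoning

HasCardinality : ∀ {c ℓ} → Setoid c ℓ → ℕ → Set (c ⊔ ℓ)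
HasCardinality S n = Inverse S (≡.setoid (Fin n))

-- In a field with finitely many elements _≈_ is decidable, and then x # y is
-- equivalent to ¬ (x ≈ y).
module _ {c ℓ₁ ℓ₂} (F : HeytingField c ℓ₁ ℓ₂) where

  open HeytingField F
  open CommutativeRing (HeytingCommutativeRing.commutativeRing heytingCommutativeRing)
    using (ring; semiring; commutativeSemiring; +-commutativeMonoid)
  open Exp semiring using (_^_; ^-congˡ)
  open Mult semiring using (_×_; ×-congʳ; ×-assoc-*; ×-assocˡ)

  -- In a finite group every integer power is a natural power, so β generates
  -- the multiplicative group exactly when its natural powers exhaust it.
  record IsPrimitiveRoot (β : Carrier) : Set (c ⊔ ℓ₁ ⊔ ℓ₂) where
    field
      β#0       : β # 0#
      generates : ∀ x → x # 0# → ∃[ k ] β ^ k ≈ x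

  -- y² + a₁xy + a₃y = x³ + a₂x² + a₄x + a₆ with the usual quantities b₂, b₄,
  -- b₆, b₈ and discriminant; this form is general in every characteristic.
  record WeierstrassCurve : Set c where
    field
      a₁ a₂ a₃ a₄ a₆ : Carrier

    b₂ b₄ b₆ b₈ Δ : Carrier
    b₂ = a₁ ^ 2 + 4 × a₂
    b₄ = 2 × a₄ + a₁ * a₃
    b₆ = a₃ ^ 2 + 4 × a₆
    b₈ = a₁ ^ 2 * a₆ + 4 × (a₂ * a₆) - a₁ * a₃ * a₄ + a₂ * a₃ ^ 2 - a₄ ^ 2
    Δ  = - (b₂ ^ 2 * b₈) - 8 × b₄ ^ 3 - 27 × b₆ ^ 2 + 9 × (b₂ * b₄ * b₆)

    Equation : Carrier → Carrier → Set ℓ₁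
    Equation x y =
      y ^ 2 + a₁ * x * y + a₃ * y ≈ x ^ 3 + a₂ * x ^ 2 + a₄ * x + a₆

  record EllipticCurve : Set (c ⊔ ℓ₂) where
    field
      weierstrassCurve : WeierstrassCurve

    open WeierstrassCurve weierstrassCurve public

    field
      Δ#0 : Δ # 0#

  AffinePoint : EllipticCurve → Set (c ⊔ ℓ₁)
  AffinePoint E = ∃[ x ] ∃[ y ] EllipticCurve.Equation E x y

  -- Points are compared by their coordinates; nothing is the point at infinity.
  points : EllipticCurve → Setoid (c ⊔ ℓ₁) (c ⊔ ℓ₁)
  points E = Maybe.setoid (On.setoid (×-setoid setoid setoid) coordinates)
    where
    coordinates : AffinePoint E → Setoid.Carrier (×-setoid setoid setoid)
    coordinates (x , y , _) = x , y

  private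
    open HeytingProperties heytingCommutativeRing
      using (invertibleˡ⇒#; x#0y#0→xy#0; #-congʳ; 1#0; x-0≈x)
    open RingProperties ring
      using (-0#≈0#; -‿distribˡ-*; -‿distribʳ-*; -‿involutive; +-cancelˡ)
    open SumProperties +-commutativeMonoid
      using (sum; sum-permute; ∑-distrib-+; sum-cong-≋; sum-replicate; sum-replicate-zero)
    open SetoidReasoning setoid

    ^-#0 : ∀ {x} n → x # 0# → x ^ n # 0#
    ^-#0 zero    x#0 = 1#0
    ^-#0 (suc n) x#0 = x#0y#0→xy#0 x#0 (^-#0 n x#0)

    unit⇒#0 : ∀ {x} y → y * x ≈ 1# → x # 0#
    unit⇒#0 {x} y yx≈1 = invertibleˡ⇒# (y , trans (*-congˡ (x-0≈x x)) yx≈1)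

    -‿#0 : ∀ {x} → x # 0# → - x # 0#
    -‿#0 {x} x#0 with #⇒invertible x#0
    ... | x⁻¹ , x⁻¹x≈1 , _ = unit⇒#0 (- x⁻¹) (begin
      - x⁻¹ * - x      ≈⟨ -‿distribˡ-* x⁻¹ (- x) ⟨
      - (x⁻¹ * - x)    ≈⟨ -‿cong (-‿distribʳ-* x⁻¹ x) ⟨
      - - (x⁻¹ * x)    ≈⟨ -‿involutive _ ⟩
      x⁻¹ * x          ≈⟨ *-congˡ (x-0≈x x) ⟨
      x⁻¹ * (x - 0#)   ≈⟨ x⁻¹x≈1 ⟩
      1#               ∎)

  -- Translation by 1 permutes the field, so the sum of all elements equals
  -- itself plus n.
  card×1≈0 : ∀ {n} → HasCardinality setoid n → n × 1# ≈ 0#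
  card×1≈0 {n} card = sym (+-cancelˡ (sum from) 0# (n × 1#) (begin
      sum from + 0#                          ≈⟨ +-identityʳ _ ⟩
      sum from                               ≈⟨ sum-permute from shift ⟩
      sum (λ i → from (shift ⟨$⟩ʳ i))        ≈⟨ sum-cong-≋ (λ i → strictlyInverseʳ (from i + 1#)) ⟩
      sum (λ i → from i + 1#)                ≈⟨ ∑-distrib-+ from (λ _ → 1#) ⟩
      sum from + sum {n} (λ _ → 1#)          ≈⟨ +-congˡ (sum-replicate n) ⟩
      sum from + n × 1#                      ∎))
    where
    open Inverse card using (to; from; to-cong; strictlyInverseˡ; strictlyInverseʳ)

    cancel : ∀ {a b} → a + b ≈ 0# → ∀ i → to (from (to (from i + a)) + b) ≡ i
    cancel {a} {b} a+b≈0 i = ≡.trans (to-cong (begin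
      from (to (from i + a)) + b  ≈⟨ +-congʳ (strictlyInverseʳ _) ⟩
      from i + a + b              ≈⟨ +-assoc _ _ _ ⟩
      from i + (a + b)            ≈⟨ +-congˡ a+b≈0 ⟩
      from i + 0#                 ≈⟨ +-identityʳ _ ⟩
      from i                      ∎)) (strictlyInverseˡ i)

    shift : Permutation′ n
    shift = permutation (λ i → to (from i + 1#)) (λ i → to (from i - 1#))
      (cancel (-‿inverseˡ 1#)) (cancel (-‿inverseʳ 1#))

  private
    3^d-odd : ∀ d → ∃[ k ] 3 ℕ.^ d ≡ 1 ℕ.+ k ℕ.* 2
    3^d-odd zero = 0 , ≡.refl
    3^d-odd (suc d) with 3^d-odd d
    ... | k , eq = 1 ℕ.+ 3 ℕ.* k , ≡.trans (≡.cong (3 ℕ.*_) eq) (lemma k)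
      where
      lemma : ∀ k → 3 ℕ.* (1 ℕ.+ k ℕ.* 2) ≡ 1 ℕ.+ (1 ℕ.+ 3 ℕ.* k) ℕ.* 2
      lemma = ℕSolver.solve-∀

  2#0 : ∀ d → HasCardinality setoid (3 ℕ.^ d) → 2 × 1# # 0#
  2#0 d card with 3^d-odd d
  ... | k , eq = unit⇒#0 (- (k × 1#)) (begin
    - (k × 1#) * 2 × 1#         ≈⟨ -‿distribˡ-* _ _ ⟨
    - (k × 1# * 2 × 1#)         ≈⟨ -‿cong (×-assoc-* k 1# (2 × 1#)) ⟩
    - (k × (1# * 2 × 1#))       ≈⟨ -‿cong (×-congʳ k (*-identityˡ _)) ⟩
    - (k × (2 × 1#))            ≈⟨ -‿cong (×-assocˡ 1# k 2) ⟩
    - m                         ≈⟨ +-identityˡ _ ⟨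
    0# - m                      ≈⟨ +-congʳ 1+m≈0 ⟨
    1# + m - m                  ≈⟨ +-assoc _ _ _ ⟩
    1# + (m - m)                ≈⟨ +-congˡ (-‿inverseʳ m) ⟩
    1# + 0#                     ≈⟨ +-identityʳ 1# ⟩
    1#                          ∎)
    where
    m : Carrier
    m = (k ℕ.* 2) × 1#

    1+m≈0 : 1# + m ≈ 0#
    1+m≈0 = ≡.subst (λ n → n × 1# ≈ 0#) eq (card×1≈0 card)

  -- Its discriminant is 64b³.
  y²≈x³-bx : 2 × 1# # 0# → ∀ b → b # 0# → EllipticCurve
  y²≈x³-bx 2#0 b b#0 = record
    { weierstrassCurve = record { a₁ = 0# ; a₂ = 0# ; a₃ = 0# ; a₄ = - b ; a₆ = 0# }
    ; Δ#0 = #-congʳ (sym (Δ≈ _)) (-‿#0 (x#0y#0→xy#0 (^-#0 6 2#0) (^-#0 3 (-‿#0 b#0))))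
    }
    where
    n×0≈0 : ∀ n → n × 0# ≈ 0#
    n×0≈0 n = trans (sym (sum-replicate n)) (sum-replicate-zero n)

    b≈0 : 0# ^ 2 + 4 × 0# ≈ 0#
    b≈0 = trans (+-cong (zeroˡ _) (n×0≈0 4)) (+-identityʳ 0#)

    0^2≈0 : (0# ^ 2 + 4 × 0#) ^ 2 ≈ 0#
    0^2≈0 = trans (*-congʳ b≈0) (zeroˡ _)

    8×[2×a]³≈2⁶a³ : ∀ a → 8 × (2 × a) ^ 3 ≈ (2 × 1#) ^ 6 * a ^ 3
    8×[2×a]³≈2⁶a³ = solve 1 (λ a →
        8 :× ((2 :× a) :^ 3) := ((2 :× con 1) :^ 6) :* (a :^ 3)) refl
      where
      open NaturalSolver commutativeSemiring

    Δ≈ : ∀ u → - ((0# ^ 2 + 4 × 0#) ^ 2 * u) - 8 × (2 × - b + 0# * 0#) ^ 3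
           - 27 × (0# ^ 2 + 4 × 0#) ^ 2
           + 9 × ((0# ^ 2 + 4 × 0#) * (2 × - b + 0# * 0#) * (0# ^ 2 + 4 × 0#))
         ≈ - ((2 × 1#) ^ 6 * (- b) ^ 3)
    Δ≈ u = begin
      _ ≈⟨ +-cong
             (+-cong
               (+-cong
                 (-‿cong (trans (*-congʳ 0^2≈0) (zeroˡ _)))
                 (-‿cong (×-congʳ 8 (^-congˡ 3 (trans (+-congˡ (zeroˡ 0#)) (+-identityʳ _))))))
               (-‿cong (trans (×-congʳ 27 0^2≈0) (n×0≈0 27))))
             (trans (×-congʳ 9 (trans (*-congˡ b≈0) (zeroʳ _))) (n×0≈0 9)) ⟩
      - 0# - 8 × (2 × - b) ^ 3 - 0# + 0#  ≈⟨ +-identityʳ _ ⟩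
      - 0# - 8 × (2 × - b) ^ 3 - 0#       ≈⟨ x-0≈x _ ⟩
      - 0# - 8 × (2 × - b) ^ 3            ≈⟨ +-congʳ -0#≈0# ⟩
      0# - 8 × (2 × - b) ^ 3              ≈⟨ +-identityˡ _ ⟩
      - (8 × (2 × - b) ^ 3)               ≈⟨ -‿cong (8×[2×a]³≈2⁶a³ (- b)) ⟩
      - ((2 × 1#) ^ 6 * (- b) ^ 3)        ∎

  module _ (d : ℕ) (card : HasCardinality setoid (3 ℕ.^ d))
           {β : Carrier} (prim : IsPrimitiveRoot β) where

    open IsPrimitiveRoot prim using (β#0)

    E E′ : EllipticCurve
    E  = y²≈x³-bx (2#0 d card) β β#0
    E′ = y²≈x³-bx (2#0 d card) (β ^ 3) (^-#0 3 β#0)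

{-# OPTIONS --safe #-}

-- For b not a square, the map φ x = x³ - bx is additive in characteristic 3
-- with kernel {x | x = 0 or x² = b} = {0}, hence a bijection of the finite
-- field. So every y occurs as the ordinate of exactly one affine point, and
-- there are q + 1 points. If β were a square, then it would equal (β²)ᵏ for
-- some k, so every nonzero x, being a power of β, would equal (x²)ᵏ; x = -1
-- would give -1 = 1. The same then holds for β³ = β · β².
module Submission where

open import Defs
open import Algebra.Apartness.Bundles using (HeytingField)
open import Data.Nat.Base using (ℕ; _+_; _^_)
open import Data.Nat.Divisibility using (_∣_)
open import Data.Product.Base using (_×_)

import Algebra.Apartness.Properties.HeytingCommutativeRing as HeytingProperties
open import Algebra.Apartness.Bundles using (HeytingCommutativeRing)
open import Algebra.Bundles using (CommutativeRing)
import Algebra.Properties.Ring as RingProperties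
import Algebra.Properties.Semiring.Exp as Exp
import Algebra.Properties.Semiring.Mult as Mult
import Algebra.Solver.Ring.NaturalCoefficients.Default as NaturalSolver
open import Data.Fin.Base using (Fin; zero; suc)
open import Data.Fin.Properties using (any?; _≟_; injective⇒≤)
open import Data.Maybe.Base using (just; nothing)
open import Data.Maybe.Relation.Binary.Pointwise using (just; nothing)
open import Data.Nat.Base as ℕ using (zero; suc)
import Data.Nat.Properties as ℕ
open import Data.Product.Base using (∃-syntax; _,_; proj₁; proj₂)
open import Function.Base using (_∘_)
open import Function.Bundles using (Inverse)
open import Function.Definitions using (Injective; StrictlySurjective)
open import Relation.Binary.Bundles using (Setoid)
open import Relation.Binary.PropositionalEquality as ≡ using (_≡_)
import Relation.Binary.Reasoning.Setoid as SetoidReasoning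
open import Relation.Nullary using (¬_; yes; no; contradiction)

-- Injective self-maps of finite sets.

injective⇒strictlySurjective : ∀ {n} {f : Fin n → Fin n} →
  Injective _≡_ _≡_ f → StrictlySurjective _≡_ f
injective⇒strictlySurjective {n} {f} inj j with any? (λ i → f i ≟ j)
... | yes hit  = hit
... | no  miss = contradiction (injective⇒≤ extended-injective) ℕ.1+n≰n
  where
  -- Pigeonhole: a missed value `j` leaves room for one more argument, which would inject
  -- `Fin (suc n)` into `Fin n`.
  extended : Fin (suc n) → Fin n
  extended zero    = j
  extended (suc i) = f i

  extended-injective : Injective _≡_ _≡_ extended
  extended-injective {zero}  {zero}  _  = ≡.refl
  extended-injective {zero}  {suc i} eq = contradiction (i , ≡.sym eq) miss
  extended-injective {suc i} {zero}  eq = contradiction (i , eq) miss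
  extended-injective {suc i} {suc k} eq = ≡.cong suc (inj eq)

module _ {c ℓ n} {S : Setoid c ℓ} (card : HasCardinality S n) where

  open Setoid S
  open Inverse card using (to; from; to-cong; from-cong; strictlyInverseˡ; strictlyInverseʳ)
  open SetoidReasoning S

  -- Conjugating by the enumeration turns `f` into an injective self-map of `Fin n`.
  finite-injective⇒strictlySurjective : ∀ {f : Carrier → Carrier} →
    Injective _≈_ _≈_ f → StrictlySurjective _≈_ f
  finite-injective⇒strictlySurjective {f} inj y
    with injective⇒strictlySurjective {f = to ∘ f ∘ from} code-injective (to y)
    where
    to-injective : Injective _≈_ _≡_ to
    to-injective {x} {z} eq = begin
      x            ≈⟨ strictlyInverseʳ x ⟨
      from (to x)  ≈⟨ from-cong eq ⟩
      from (to z)  ≈⟨ strictlyInverseʳ z ⟩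
      z            ∎

    code-injective : Injective _≡_ _≡_ (to ∘ f ∘ from)
    code-injective {i} {j} eq =
      ≡.trans (≡.sym (strictlyInverseˡ i))
        (≡.trans (to-cong (inj (to-injective eq))) (strictlyInverseˡ j))
  ... | i , eq = from i , (begin
    f (from i)             ≈⟨ strictlyInverseʳ _ ⟨
    from (to (f (from i))) ≈⟨ from-cong eq ⟩
    from (to y)            ≈⟨ strictlyInverseʳ y ⟩
    y                      ∎)

-- Apartness, characteristic and powers in a field.

module _ {c ℓ₁ ℓ₂} (F : HeytingField c ℓ₁ ℓ₂) where

  open HeytingField F hiding (zero) renaming (_+_ to _⊕_)
  open CommutativeRing (HeytingCommutativeRing.commutativeRing heytingCommutativeRing)
    using (ring; semiring; commutativeSemiring)
  open HeytingProperties heytingCommutativeRing using (x#0y#0→xy#0; 1#0; x-0≈x)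
  open RingProperties ring
    using (+-cancelˡ; +-inverseˡ-unique; -1*x≈-x; -‿involutive)
  open Exp semiring using (^-congˡ; ^-congʳ; ^-assocʳ) renaming (_^_ to _↑_)
  open Mult semiring using (×1-homo-*; ×-homo-1) renaming (_×_ to _·_)
  open NaturalSolver commutativeSemiring
  open SetoidReasoning setoid

  -- Tightness yields apartness only up to double negation, which is enough when the goal is
  -- absurdity.
  ≉⇒¬¬# : ∀ {x y} → ¬ x ≈ y → ¬ ¬ x # y
  ≉⇒¬¬# x≉y ¬x#y = x≉y (proj₁ (tight _ _) ¬x#y)

  #⇒≉ : ∀ {x y} → x # y → ¬ x ≈ y
  #⇒≉ x#y x≈y = proj₂ (tight _ _) x≈y x#y

  x#0∧xy≈0⇒y≈0 : ∀ {x y} → x # 0# → x * y ≈ 0# → y ≈ 0#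
  x#0∧xy≈0⇒y≈0 x#0 xy≈0 =
    proj₁ (tight _ _) (λ y#0 → #⇒≉ (x#0y#0→xy#0 x#0 y#0) xy≈0)

  -- Were `p · 1#` apart from zero, one factor could be cancelled and the induction hypothesis would
  -- make it zero after all. The case `d = 0` would say 1 = 0.
  p^d≈0⇒p≈0 : ∀ p d → (p ^ d) · 1# ≈ 0# → p · 1# ≈ 0#
  p^d≈0⇒p≈0 p zero    1≈0 = contradiction (trans (sym (×-homo-1 1#)) 1≈0) (#⇒≉ 1#0)
  p^d≈0⇒p≈0 p (suc d) p^[1+d]≈0 = proj₁ (tight _ _) λ p#0 →
    #⇒≉ p#0 (p^d≈0⇒p≈0 p d
      (x#0∧xy≈0⇒y≈0 p#0 (trans (sym (×1-homo-* p (p ^ d))) p^[1+d]≈0)))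

  x#0⇒xⁿ#0 : ∀ {x} n → x # 0# → x ↑ n # 0#
  x#0⇒xⁿ#0 zero    x#0 = 1#0
  x#0⇒xⁿ#0 (suc n) x#0 = x#0y#0→xy#0 x#0 (x#0⇒xⁿ#0 n x#0)

  1^k≈1 : ∀ k → 1# ↑ k ≈ 1#
  1^k≈1 zero    = refl
  1^k≈1 (suc k) = trans (*-identityˡ _) (1^k≈1 k)

  ^-comm : ∀ x m n → (x ↑ m) ↑ n ≈ (x ↑ n) ↑ m
  ^-comm x m n = begin
    (x ↑ m) ↑ n    ≈⟨ ^-assocʳ x m n ⟩
    x ↑ (m ℕ.* n)  ≈⟨ ^-congʳ x (ℕ.*-comm m n) ⟩
    x ↑ (n ℕ.* m)  ≈⟨ ^-assocʳ x n m ⟨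
    (x ↑ n) ↑ m    ∎

  -1^2≈1 : (- 1#) ↑ 2 ≈ 1#
  -1^2≈1 = begin
    - 1# * (- 1# * 1#) ≈⟨ *-congˡ (*-identityʳ _) ⟩
    - 1# * - 1#        ≈⟨ -1*x≈-x (- 1#) ⟩
    - - 1#             ≈⟨ -‿involutive 1# ⟩
    1#                 ∎

  -1≉0 : ¬ - 1# ≈ 0#
  -1≉0 -1≈0 = #⇒≉ 1#0 (begin
    1#            ≈⟨ -1^2≈1 ⟨
    (- 1#) ↑ 2    ≈⟨ *-congʳ -1≈0 ⟩
    0# * _        ≈⟨ zeroˡ _ ⟩
    0#            ∎)

  -- Nonsquares from a primitive root.

  module _ {β} (prim : IsPrimitiveRoot F β) (2#0 : 2 · 1# # 0#) where

    open IsPrimitiveRoot prim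

    primitiveRoot-nonsquare : ∀ z → ¬ z ↑ 2 ≈ β
    primitiveRoot-nonsquare z z²≈β =
      -- `generates` asks for apartness from zero; the goal being absurd, both double negations can
      -- be stripped.
      ≉⇒¬¬# z≉0 λ z#0 → ≉⇒¬¬# -1≉0 λ -1#0 →
        #⇒≉ 2#0 (2≈0 (generates z z#0) (generates (- 1#) -1#0))
      where
      z≉0 : ¬ z ≈ 0#
      z≉0 z≈0 = #⇒≉ β#0 (trans (sym z²≈β) (trans (*-congʳ z≈0) (zeroˡ _)))

      2≈0 : ∃[ k ] β ↑ k ≈ z → ∃[ j ] β ↑ j ≈ - 1# → 2 · 1# ≈ 0#
      2≈0 (k , βᵏ≈z) (j , βʲ≈-1) = begin
        1# ⊕ (1# ⊕ 0#)  ≈⟨ +-congˡ (+-identityʳ 1#) ⟩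
        1# ⊕ 1#         ≈⟨ +-congˡ -1≈1 ⟨
        1# ⊕ - 1#       ≈⟨ -‿inverseʳ 1# ⟩
        0#              ∎
        where
        -1≈1 : - 1# ≈ 1#
        -- The exponents are reordered so that `j` acts on `β` first: this restores -1 inside, and
        -- the outer square then gives 1.
        -1≈1 = begin
          - 1#                ≈⟨ βʲ≈-1 ⟨
          β ↑ j               ≈⟨ ^-congˡ j z²≈β ⟨
          (z ↑ 2) ↑ j         ≈⟨ ^-congˡ j (^-congˡ 2 βᵏ≈z) ⟨
          ((β ↑ k) ↑ 2) ↑ j   ≈⟨ ^-comm (β ↑ k) 2 j ⟩
          ((β ↑ k) ↑ j) ↑ 2   ≈⟨ ^-congˡ 2 (^-comm β k j) ⟩
          ((β ↑ j) ↑ k) ↑ 2   ≈⟨ ^-congˡ 2 (^-congˡ k βʲ≈-1) ⟩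
          ((- 1#) ↑ k) ↑ 2    ≈⟨ ^-comm (- 1#) k 2 ⟩
          ((- 1#) ↑ 2) ↑ k    ≈⟨ ^-congˡ k -1^2≈1 ⟩
          1# ↑ k              ≈⟨ 1^k≈1 k ⟩
          1#                  ∎

    -- Dividing a square root of β³ by β would give a square root of β.
    primitiveRoot³-nonsquare : ∀ z → ¬ z ↑ 2 ≈ β ↑ 3
    primitiveRoot³-nonsquare z z²≈β³ with #⇒invertible β#0
    ... | β⁻¹ , β⁻¹*[β-0]≈1 , _ = primitiveRoot-nonsquare (β⁻¹ * z) (begin
      (β⁻¹ * z) ↑ 2          ≈⟨ solve 2 (λ i z → (i :* z) :^ 2 := (i :^ 2) :* (z :^ 2)) refl β⁻¹ z ⟩
      β⁻¹ ↑ 2 * z ↑ 2        ≈⟨ *-congˡ z²≈β³ ⟩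
      β⁻¹ ↑ 2 * β ↑ 3        ≈⟨ solve 2 (λ i b → (i :^ 2) :* (b :^ 3) := ((i :* b) :^ 2) :* b) refl β⁻¹ β ⟩
      -- `#⇒invertible` inverts the difference `β - 0#`, hence the detour through `x-0≈x`.
      (β⁻¹ * β) ↑ 2 * β      ≈⟨ *-congʳ (^-congˡ 2 (trans (*-congˡ (sym (x-0≈x β))) β⁻¹*[β-0]≈1)) ⟩
      1# ↑ 2 * β             ≈⟨ *-congʳ (1^k≈1 2) ⟩
      1# * β                 ≈⟨ *-identityˡ β ⟩
      β                      ∎)

  -- The additive cubic map in characteristic 3.

  module _ (3≈0 : 3 · 1# ≈ 0#) (b : Carrier) (b-nonsquare : ∀ z → ¬ z ↑ 2 ≈ b) where

    -- The linear coefficient stays `- b`, as in `a₄` of the curve; the semiring solver, which knows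
    -- no negation, treats it as an atom.
    φ : Carrier → Carrier
    φ x = x ↑ 3 ⊕ - b * x

    φ-cong : ∀ {x y} → x ≈ y → φ x ≈ φ y
    φ-cong x≈y = +-cong (^-congˡ 3 x≈y) (*-congˡ x≈y)

    φ-homo : ∀ x y → φ (x ⊕ y) ≈ φ x ⊕ φ y
    φ-homo x y = begin
      φ (x ⊕ y)
        -- The cross terms of the cube are collected as a multiple of `3 · 1#`, which vanishes.
        ≈⟨ solve 3 (λ a x y →
             ((x :+ y) :^ 3) :+ a :* (x :+ y)
               := ((x :^ 3) :+ a :* x) :+ ((y :^ 3) :+ a :* y) :+ (3 :× con 1) :* (x :* y :* (x :+ y)))
             refl (- b) x y ⟩
      φ x ⊕ φ y ⊕ 3 · 1# * (x * y * (x ⊕ y))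
        ≈⟨ +-congˡ (trans (*-congʳ 3≈0) (zeroˡ _)) ⟩
      φ x ⊕ φ y ⊕ 0#
        ≈⟨ +-identityʳ _ ⟩
      φ x ⊕ φ y ∎

    -- Here φ z = z(z² - b), so a root apart from zero would be a square root of `b`.
    φ-kernel : ∀ z → φ z ≈ 0# → z ≈ 0#
    φ-kernel z φz≈0 = proj₁ (tight _ _) λ z#0 → b-nonsquare z (begin
      z ↑ 2    ≈⟨ +-inverseˡ-unique _ _ (x#0∧xy≈0⇒y≈0 z#0 (trans (z[z²+a]≈φz (- b)) φz≈0)) ⟩
      - - b    ≈⟨ -‿involutive b ⟩
      b        ∎)
      where
      z[z²+a]≈φz : ∀ a → z * (z ↑ 2 ⊕ a) ≈ z ↑ 3 ⊕ a * z
      z[z²+a]≈φz a = solve 2 (λ z a → z :* ((z :^ 2) :+ a) := (z :^ 3) :+ a :* z) refl z a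

    φ-injective : Injective _≈_ _≈_ φ
    φ-injective {x} {y} φx≈φy = begin
      x              ≈⟨ x≈y+[x-y] ⟩
      y ⊕ (x - y)    ≈⟨ +-congˡ (φ-kernel (x - y) φ[x-y]≈0) ⟩
      y ⊕ 0#         ≈⟨ +-identityʳ y ⟩
      y              ∎
      where
      x≈y+[x-y] : x ≈ y ⊕ (x - y)
      x≈y+[x-y] = begin
        x              ≈⟨ +-identityʳ x ⟨
        x ⊕ 0#         ≈⟨ +-congˡ (-‿inverseˡ y) ⟨
        x ⊕ (- y ⊕ y)  ≈⟨ +-assoc x (- y) y ⟨
        x - y ⊕ y      ≈⟨ +-comm _ _ ⟩
        y ⊕ (x - y)    ∎

      φ[x-y]≈0 : φ (x - y) ≈ 0#
      -- Additivity is applied to x = y + (x - y), so that φ(-y) never has to be computed.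
      φ[x-y]≈0 = +-cancelˡ (φ y) _ _ (begin
        φ y ⊕ φ (x - y)  ≈⟨ φ-homo y (x - y) ⟨
        φ (y ⊕ (x - y))  ≈⟨ φ-cong x≈y+[x-y] ⟨
        φ x              ≈⟨ φx≈φy ⟩
        φ y              ≈⟨ +-identityʳ _ ⟨
        φ y ⊕ 0#         ∎)

    -- Counting points by their ordinates.

    module _ {n} (card : HasCardinality setoid n) (2#0 : 2 · 1# # 0#) (b#0 : b # 0#) where

      private
        C : EllipticCurve F
        C = y²≈x³-bx F 2#0 b b#0

      open EllipticCurve C using (Equation)
      open Inverse card using (to; from; to-cong; inverseˡ; strictlyInverseʳ)

      -- The general Weierstrass equation still carries its zero coefficients; this and `rhs≈φx`
      -- remove them.
      lhs≈y² : ∀ x y → y ↑ 2 ⊕ 0# * x * y ⊕ 0# * y ≈ y ↑ 2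
      lhs≈y² = solve 2 (λ x y → (y :^ 2) :+ con 0 :* x :* y :+ con 0 :* y := y :^ 2) refl

      rhs≈φx : ∀ x → x ↑ 3 ⊕ 0# * x ↑ 2 ⊕ - b * x ⊕ 0# ≈ φ x
      rhs≈φx x = solve 2 (λ a x →
        (x :^ 3) :+ con 0 :* (x :^ 2) :+ a :* x :+ con 0 := (x :^ 3) :+ a :* x) refl (- b) x

      Equation⇒φx≈y² : ∀ x y → Equation x y → φ x ≈ y ↑ 2
      Equation⇒φx≈y² x y eq = trans (sym (rhs≈φx x)) (trans (sym eq) (lhs≈y² x y))

      φx≈y²⇒Equation : ∀ x y → φ x ≈ y ↑ 2 → Equation x y
      φx≈y²⇒Equation x y eq = trans (lhs≈y² x y) (trans (sym eq) (sym (rhs≈φx x)))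

      abscissa : ∀ y → ∃[ x ] φ x ≈ y ↑ 2
      abscissa y = finite-injective⇒strictlySurjective card φ-injective (y ↑ 2)

      card-points : HasCardinality (points F C) (suc n)
      card-points = record
        { to        = encode
        ; from      = decode
        ; to-cong   = λ where
            (just (_ , y≈y′)) → ≡.cong suc (to-cong y≈y′)
            nothing           → ≡.refl
        ; from-cong = λ where ≡.refl → Setoid.refl (points F C)
        ; inverse   = inverseˡ′ _ , inverseʳ′ _
        }
        where
        open Setoid (points F C) using () renaming (Carrier to Point; _≈_ to _≈ₚ_)

        encode : Point → Fin (suc n)
        encode nothing            = zero
        encode (just (_ , y , _)) = suc (to y)

        decode : Fin (suc n) → Point
        decode zero    = nothing
        decode (suc i) =
          just (proj₁ (abscissa y) , y , φx≈y²⇒Equation _ y (proj₂ (abscissa y)))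
          where y = from i

        inverseˡ′ : ∀ i {P} → P ≈ₚ decode i → encode P ≡ i
        inverseˡ′ zero    nothing           = ≡.refl
        inverseˡ′ (suc i) (just (_ , y≈y′)) = ≡.cong suc (inverseˡ y≈y′)

        inverseʳ′ : ∀ P {i} → i ≡ encode P → decode i ≈ₚ P
        inverseʳ′ nothing             ≡.refl = nothing
        -- The chosen abscissa and `x` both have image y² under φ, so injectivity identifies them.
        inverseʳ′ (just (x , y , eq)) ≡.refl = just (φ-injective (begin
          φ (proj₁ (abscissa (from (to y))))  ≈⟨ proj₂ (abscissa (from (to y))) ⟩
          from (to y) ↑ 2                     ≈⟨ ^-congˡ 2 (strictlyInverseʳ y) ⟩
          y ↑ 2                               ≈⟨ Equation⇒φx≈y² x y eq ⟨
          φ x                                 ∎) , strictlyInverseʳ y)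

proposition3p5 : ∀ {c ℓ₁ ℓ₂} (F : HeytingField c ℓ₁ ℓ₂) (d : ℕ) → 2 ∣ d →
    (card : HasCardinality (HeytingField.setoid F) (3 ^ d)) →
    (β : HeytingField.Carrier F) (prim : IsPrimitiveRoot F β) →
    HasCardinality (points F (E F d card prim)) (3 ^ d + 1) ×
    HasCardinality (points F (E′ F d card prim)) (3 ^ d + 1)
proposition3p5 F d _ card β prim =
  ≡.subst (HasCardinality (points F (E F d card prim))) (ℕ.+-comm 1 (3 ^ d))
    (card-points F 3≈0 _ (primitiveRoot-nonsquare F prim 2#0′) card 2#0′ β#0) ,
  ≡.subst (HasCardinality (points F (E′ F d card prim))) (ℕ.+-comm 1 (3 ^ d))
    (card-points F 3≈0 _ (primitiveRoot³-nonsquare F prim 2#0′) card 2#0′ (x#0⇒xⁿ#0 F 3 β#0))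
  where
  open IsPrimitiveRoot prim using (β#0)
  2#0′ = 2#0 F d card
  -- The field order annihilates 1 and is a power of 3, so 3 itself vanishes.
  3≈0 = p^d≈0⇒p≈0 F 3 d (card×1≈0 F card)
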